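{- Assume Markov induction. For every oracle $\chi:\mathbb{N}\to\nabla_0\mathbb{N}$ we have $\chi\equiv_T\overline{\chi}$, where $\overline{\chi}:\mathbb{N}\times\mathbb{N}\to\nabla_0 2$ is the graph of $\chi$.
   Context: Setting: homotopy type theory with a univalent universe $\mathcal{U}$ of small types and higher inductive types. It is assumed that there is a small type $\Omega_{\neg\neg}:\mathcal{U}$ classifying $\neg\neg$-stable propositions. For a type $X$, $\nabla_0X$ is the type of $\xi:X\to\Omega_{\neg\neg}$ such that $\neg\neg\sum_{x:X}\xi(x)$ and $\prod_{x,y:X}\xi(x)\to\xi(y)\to\neg\neg(x=y)$; write $\xi\downarrow:=\sum_{x:X}\xi(x)$ and $\xi\downarrow=x$ for $\xi(x)$. For a higher modality $\bigcirc$, a type $X$ is $\bigcirc$-connected if $\bigcirc X$ is contractible. The nullification at a family $B:A\to\mathcal{U}$ is the higher modality whose modal types are the $X$ with every constant map $X\to X^{B(a)}$ an equivalence. An oracle is a map $\chi:A\to\nabla_0B$; $\bigcirc_\chi$ is the nullification at $a\mapsto\chi(a)\downarrow$. For higher modalities $\bigcirc\le_T\Diamond$ means every $\bigcirc$-connected type is $\Diamond$-connected; $\chi\le_T\chi'$ means $\bigcirc_\chi\le_T\bigcirc_{\chi'}$; $\chi\equiv_T\chi'$ means $\bigcirc_\chi=\bigcirc_{\chi'}$. The graph $\overline{\chi}(a,b)$ is the element $\xi:\nabla_0 2$ with $\xi(1):=(\chi(a)\downarrow=b)$ and $\xi(0):=\neg(\chi(a)\downarrow=b)$ (so $\overline\chi(a,b)\downarrow=1$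 iff $\chi(a)\downarrow=b$, and $\overline\chi(a,b)\downarrow=0$ otherwise). Markov induction (MI): write $\mathtt{IsSuc}(\mu,\nu):=\prod_{m:\mathbb{N}}(\mu\downarrow=m)\to(\nu\downarrow=m+1)$ for $\mu,\nu:\nabla_0\mathbb{N}$; MI asserts that for every $P:\nabla_0\mathbb{N}\to\mathcal{U}$ and every $h:\prod_{\nu:\nabla_0\mathbb{N}}\left(\prod_{\mu:\nabla_0\mathbb{N}}\mathtt{IsSuc}(\mu,\nu)\to P(\mu)\right)\to P(\nu)$ there is a section $\prod_{\nu:\nabla_0\mathbb{N}}P(\nu)$. -}

{-# OPTIONS --without-K #-}
module Defs where

open import Axiom.Extensionality.Propositional using (Extensionality)
open import Data.Bool.Base using (Bool; true; false)
open import Data.Nat.Base using (ℕ; _+_)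
open import Data.Product.Base using (Σ; Σ-syntax; _×_; _,_; proj₁; proj₂)
open import Function.Base using (const; id)
open import Function.Bundles using (_⇔_)
open import Level using (Level; _⊔_; Setω)
open import Relation.Binary.PropositionalEquality.Core using (_≡_; refl; sym; cong; subst)
open import Relation.Nullary.Irrelevant using (Irrelevant)
open import Relation.Nullary.Negation.Core using (¬_; Stable; negated-stable; contradiction)

private
  variable
    a b : Level

-- Everything here is meant without axiom K, which contradicts univalence.
-- The univalent universe 𝒰 is `Set`.  `Irrelevant P` is "P is a (homotopy)
-- proposition" and `Stable P` is ¬¬ P → P.

isContr : Set a → Set a
isContr A = Σ[ x ∈ A ] (∀ y → x ≡ y)

isEquiv : {A : Set a} {B : Set b} → (A → B) → Set (a ⊔ b)
isEquiv {A = A} f = ∀ y → isContr (Σ[ x ∈ A ] f x ≡ y)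

infix 4 _≃_
_≃_ : Set a → Set b → Set (a ⊔ b)
A ≃ B = Σ[ f ∈ (A → B) ] isEquiv f

id-≃ : (A : Set a) → A ≃ A
id-≃ A = id , λ y → (y , refl) , λ { (_ , refl) → refl }

≡⇒≃ : {A B : Set} → A ≡ B → A ≃ B
≡⇒≃ {A} refl = id-≃ A

Univalence : Set₁
Univalence = ∀ (A B : Set) → isEquiv (≡⇒≃ {A} {B})

-- Univalence of `Set` gives extensionality only for functions between small
-- types, so extensionality at higher levels is a separate assumption.
FunExt : Setω
FunExt = ∀ (a b : Level) → Extensionality a b

-- Higher modalities on 𝒰 in the sense of Rijke, Shulman and Spitters.
record HigherModality : Set₁ where
  field
    ◯         : Set → Set
    η         : ∀ (A : Set) → A → ◯ A
    ind       : ∀ (A : Set) (P : ◯ A → Set) →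
                (∀ x → ◯ (P (η A x))) → ∀ z → ◯ (P z)
    ind-η     : ∀ (A : Set) (P : ◯ A → Set) (f : ∀ x → ◯ (P (η A x))) →
                ∀ x → ind A P f (η A x) ≡ f x
    η-≡-equiv : ∀ (A : Set) (y z : ◯ A) → isEquiv (η (y ≡ z))

  IsModal : Set → Set
  IsModal X = isEquiv (η X)

IsNull : {A : Set} → (A → Set) → Set → Set
IsNull B X = ∀ a → isEquiv (λ (x : X) → const {B = B a} x)

IsNullificationAt : {A : Set} → (A → Set) → HigherModality → Set₁
IsNullificationAt B M = ∀ X → HigherModality.IsModal M X ⇔ IsNull B X

-- Agda without cubical features has no higher inductive types.  The
-- nullification at B is determined up to equality by IsNullificationAt B.
Nullifications : Set₁
Nullifications = ∀ {A : Set} (B : A → Set) → Σ HigherModality (IsNullificationAt B)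

StableProp : Set₁
StableProp = Σ[ P ∈ Set ] Irrelevant P × Stable P

record StableClassifier : Set₁ where
  field
    Ω        : Set
    classify : Ω ≃ StableProp

  El : Ω → Set
  El ω = proj₁ (proj₁ classify ω)

  code : StableProp → Ω
  code P = proj₁ (proj₁ (proj₂ classify P))

  El-code : ∀ P → El (code P) ≡ proj₁ P
  El-code P = cong proj₁ (proj₂ (proj₁ (proj₂ classify P)))

-- Irrelevance holds by refl: the library's ⊥ is definitionally proof-irrelevant.
negation : Set → StableProp
negation A = (¬ A) , (λ _ _ → refl) , negated-stable

record ∇₀ (Ω¬¬ : StableClassifier) (X : Set) : Set where
  open StableClassifier Ω¬¬
  field
    ξ         : X → Ω
    inhabited : ¬ ¬ (Σ[ x ∈ X ] El (ξ x))
    unique    : ∀ x y → El (ξ x) → El (ξ y) → ¬ ¬ (x ≡ y)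

module _ {Ω¬¬ : StableClassifier} where
  open StableClassifier Ω¬¬

  infix 4 _↓=_
  _↓=_ : {X : Set} → ∇₀ Ω¬¬ X → X → Set
  ν ↓= x = El (∇₀.ξ ν x)

  _↓ : {X : Set} → ∇₀ Ω¬¬ X → Set
  _↓ {X} ν = Σ[ x ∈ X ] ν ↓= x

  IsSuc : ∇₀ Ω¬¬ ℕ → ∇₀ Ω¬¬ ℕ → Set
  IsSuc μ ν = ∀ m → μ ↓= m → ν ↓= m + 1

MarkovInduction : StableClassifier → Set₁
MarkovInduction Ω¬¬ =
  ∀ (P : ∇₀ Ω¬¬ ℕ → Set) →
  (∀ ν → (∀ μ → IsSuc μ ν → P μ) → P ν) →
  ∀ ν → P ν

Oracle : StableClassifier → Set → Set → Set
Oracle Ω¬¬ A B = A → ∇₀ Ω¬¬ B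

module _ {Ω¬¬ : StableClassifier} where
  open StableClassifier Ω¬¬

  oracleModality : Nullifications → {A B : Set} → Oracle Ω¬¬ A B → HigherModality
  oracleModality nullify χ = proj₁ (nullify (λ a → χ a ↓))

  TuringEquivalent : Nullifications → {A B A′ B′ : Set} →
                     Oracle Ω¬¬ A B → Oracle Ω¬¬ A′ B′ → Set₁
  TuringEquivalent nullify χ χ′ = oracleModality nullify χ ≡ oracleModality nullify χ′

  -- The two elements 1 and 0 of the type 2 are `true` and `false`.
  graph : {A B : Set} → Oracle Ω¬¬ A B → Oracle Ω¬¬ (A × B) Bool
  graph χ (a , b) = record { ξ = ξ ; inhabited = inhabited ; unique = unique }
    where
    ¬P : StableProp
    ¬P = negation (χ a ↓= b)

    ξ : Bool → Ω
    ξ true  = ∇₀.ξ (χ a) b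
    ξ false = code ¬P

    inhabited : ¬ ¬ (Σ[ i ∈ Bool ] El (ξ i))
    inhabited none =
      none (false , subst id (sym (El-code ¬P)) (λ p → none (true , p)))

    unique : ∀ i j → El (ξ i) → El (ξ j) → ¬ ¬ (i ≡ j)
    unique true  true  _ _ = contradiction refl
    unique false false _ _ = contradiction refl
    unique true  false p q = contradiction p (subst id (El-code ¬P) q)
    unique false true  q p = contradiction p (subst id (El-code ¬P) q)

{-# OPTIONS --safe #-}
{-# OPTIONS --without-K #-}
-- A modality ◯ is determined by its modal types: univalence identifies any two
-- reflections of a type, and ◯-induction is unique because ◯-types and their
-- identity types are modal.  So it suffices that both oracles have the same null
-- types, and since χ(a)↓ and χ̄(a,b)↓ are propositions, it suffices that each modality
-- inhabits its reflections of the other family.  From χ(a)↓ = m one decides m = b.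
-- Conversely, to inhabit ◯(χ(a)↓), ask the graph whether χ(a)↓ = 0, 1, 2, …; Markov
-- induction, applied to the "remaining distance" to the value of χ(a), makes this
-- unbounded search legitimate.
module Submission where

open import Defs
open import Data.Bool.Base using (true; false)
import Data.Bool.Properties as Bool
open import Data.Nat.Base using (ℕ; zero; suc; _+_)
open import Data.Nat.Properties using (_≟_; +-assoc; +-comm; +-cancelʳ-≡)
open import Data.Product.Base using (Σ-syntax; _,_; proj₁; proj₂)
open import Function.Base using (_∘_; const; id)
open import Function.Bundles using (_⇔_; mk⇔; mk↔ₛ′; module Equivalence)
open import Function.Properties.Inverse.HalfAdjointEquivalence using (↔⇒≃; module _≃_)
open import Level using (Level)
open import Relation.Binary.Definitions using (DecidableEquality)
open import Relation.Binary.PropositionalEquality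
open import Relation.Nullary.Decidable using (yes; no; decidable-stable)
open import Relation.Nullary.Irrelevant using (Irrelevant)
open import Relation.Nullary.Negation.Core using (¬_)

private
  variable
    a b : Level

-- Equivalences, contractibility and extensionality

module _ {A : Set a} {B : Set b} {f : A → B} (e : isEquiv f) where

  inverse : B → A
  inverse y = proj₁ (proj₁ (e y))

  inverseʳ : ∀ y → f (inverse y) ≡ y
  inverseʳ y = proj₂ (proj₁ (e y))

  inverseˡ : ∀ x → inverse (f x) ≡ x
  inverseˡ x = cong proj₁ (proj₂ (e (f x)) (x , refl))

-- The two-sided inverse is first made half adjoint; its triangle identity `left-right` is the
-- coherence that `fibre-≡` needs to contract a fibre.
isEquiv-fromInverse : {A : Set a} {B : Set b} (f : A → B) (g : B → A) →
                      (∀ y → f (g y) ≡ y) → (∀ x → g (f x) ≡ x) → isEquiv f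
isEquiv-fromInverse {A = A} f g fg gf y =
  (g y , right-inverse-of y) ,
  λ { (x , refl) → fibre-≡ (left-inverse-of x) (left-right x) }
  where
  open _≃_ (↔⇒≃ (mk↔ₛ′ f g fg gf))

  fibre-≡ : ∀ {x x′ : A} {q : f x ≡ f x′} (p : x ≡ x′) → cong f p ≡ q →
            (x , q) ≡ (x′ , refl)
  fibre-≡ refl refl = refl

isContr⇒irrelevant : {A : Set a} → isContr A → Irrelevant A
isContr⇒irrelevant (c , h) x y = trans (sym (h x)) (h y)

singleton-isContr : {A : Set a} (x : A) → isContr (Σ[ y ∈ A ] x ≡ y)
singleton-isContr x = (x , refl) , λ { (_ , refl) → refl }

module _ (fe : FunExt) where

  Π-irrelevant : {A : Set a} {B : A → Set b} →
                 (∀ x → Irrelevant (B x)) → Irrelevant (∀ x → B x)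
  Π-irrelevant {a} {b} h f g = fe a b λ x → h x (f x) (g x)

  isContr-irrelevant : {A : Set a} → Irrelevant (isContr A)
  isContr-irrelevant {a} {A} (c , h) (d , k) = aux (h d) h k
    where
    identity-irrelevant : (x y : A) → Irrelevant (x ≡ y)
    identity-irrelevant x y p q =
      trans (sym (via-centre p)) (via-centre q)
      where
      via-centre : ∀ {y} (r : x ≡ y) → trans (sym (h x)) (h y) ≡ r
      via-centre refl = trans-symˡ (h x)

    aux : ∀ {c d} → c ≡ d → (h : ∀ y → c ≡ y) (k : ∀ y → d ≡ y) → (c , h) ≡ (d , k)
    aux refl h k = cong (_ ,_) (Π-irrelevant (λ _ → identity-irrelevant _ _) h k)

  isEquiv-irrelevant : {A : Set a} {B : Set b} (f : A → B) → Irrelevant (isEquiv f)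
  isEquiv-irrelevant f = Π-irrelevant λ _ → isContr-irrelevant

  -- The type of pairs (g , h) is a retract of ∀ x → Σ[ y ∈ B x ] f x ≡ y, so the
  -- bare extensionality axiom is enough to induct on homotopies.
  homotopy-induction : {A : Set a} {B : A → Set b} {ℓ : Level} (f : ∀ x → B x)
                       (C : (g : ∀ x → B x) → (∀ x → f x ≡ g x) → Set ℓ) →
                       C f (λ _ → refl) → ∀ g h → C g h
  homotopy-induction f C c g h =
    subst (λ s → C (proj₁ ∘ s) (proj₂ ∘ s))
      (Π-irrelevant (λ x → isContr⇒irrelevant (singleton-isContr (f x)))
        (λ x → f x , refl) (λ x → g x , h x))
      c

≡-fromEquiv : Univalence → {A B : Set} → A ≃ B → A ≡ B
≡-fromEquiv ua {A} {B} = inverse (ua A B)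

-- Properties of a single modality

module ModalityProperties (M : HigherModality) where
  open HigherModality M

  ◯-modal : ∀ A → IsModal (◯ A)
  ◯-modal A = isEquiv-fromInverse (η (◯ A)) join η-join join-η
    where
    join : ◯ (◯ A) → ◯ A
    join = ind (◯ A) (λ _ → A) id

    join-η : ∀ z → join (η (◯ A) z) ≡ z
    join-η = ind-η (◯ A) (λ _ → A) id

    η-join : ∀ w → η (◯ A) (join w) ≡ w
    -- The goal is an identity in `◯ (◯ A)`, hence modal, so it may be proved under `◯` by induction
    -- on `w`.
    η-join w = inverse (η-≡-equiv (◯ A) _ w)
      (ind (◯ A) (λ w → η (◯ A) (join w) ≡ w) (λ z → η _ (cong (η (◯ A)) (join-η z))) w)

  module _ {A : Set} {P : ◯ A → Set} (m : ∀ z → IsModal (P z))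
           (f : ∀ x → P (η A x)) where

    elim : ∀ z → P z
    elim z = inverse (m z) (ind A P (λ x → η _ (f x)) z)

    elim-η : ∀ x → elim (η A x) ≡ f x
    elim-η x = trans (cong (inverse (m (η A x))) (ind-η A P _ x)) (inverseˡ (m (η A x)) (f x))

  rec : {A X : Set} → IsModal X → (A → X) → ◯ A → X
  rec m = elim (λ _ → m)

  rec-η : {A X : Set} (m : IsModal X) (f : A → X) → ∀ x → rec m f (η A x) ≡ f x
  rec-η m = elim-η (λ _ → m)

  ◯-map : {A B : Set} → (A → B) → ◯ A → ◯ B
  ◯-map f = ind _ _ (η _ ∘ f)

  Extension : (A : Set) (P : ◯ A → Set) → (∀ x → ◯ (P (η A x))) → Set
  Extension A P f = Σ[ g ∈ (∀ z → ◯ (P z)) ] (∀ x → g (η A x) ≡ f x)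

  -- `g z ≡ g′ z` is modal, so `elim` extends the agreement on `η` to a homotopy. By `elim-η` that
  -- homotopy restricts to `trans (p x) (sym (p′ x))`, which is what identifies `p` with `p′`.
  extension-irrelevant : FunExt → ∀ {A P} f → Irrelevant (Extension A P f)
  extension-irrelevant fe {A} {P} f (g , p) (g′ , p′) =
    homotopy-induction fe g
      (λ g′ h → ∀ p′ → (∀ x → h (η A x) ≡ trans (p x) (sym (p′ x))) → (g , p) ≡ (g′ , p′))
      (λ p′ q → cong (g ,_) (fe _ _ λ x → cancel (p x) (p′ x) (q x)))
      g′ (elim modal λ x → trans (p x) (sym (p′ x))) p′ (elim-η modal _)
    where
    modal : ∀ z → IsModal (g z ≡ g′ z)
    modal z = η-≡-equiv (P z) (g z) (g′ z)

    cancel : {X : Set} {x y : X} (p q : x ≡ y) → refl ≡ trans p (sym q) → p ≡ q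
    cancel p refl r = sym (trans r (trans-reflʳ p))

  module _ (ua : Univalence) where

    -- `η-≡-equiv` covers only types of the form `◯ X`; univalence identifies a modal `X` with its
    -- own `◯ X`.
    ≡-modal : ∀ {X} → IsModal X → (x y : X) → IsModal (x ≡ y)
    ≡-modal {X} m =
      subst (λ Y → (x y : Y) → IsModal (x ≡ y)) (sym (≡-fromEquiv ua (η X , m))) (η-≡-equiv X)

    -- The inverse of `const` evaluates `f` at the point of `◯ Q`; irrelevance of `Q` makes this
    -- value agree with every `f q`.
    modal⇒null : FunExt → ∀ {Q X} → Irrelevant Q → ◯ Q → IsModal X →
                 isEquiv (λ (x : X) → const {B = Q} x)
    modal⇒null fe {Q} {X} irr z m =
      isEquiv-fromInverse const
        (λ f → rec m f z)
        (λ f → fe _ _ λ q → elim {P = λ z → rec m f z ≡ f q} (λ _ → ≡-modal m _ _)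
           (λ q′ → trans (rec-η m f q′) (cong f (irr q′ q))) z)
        (λ x → elim {P = λ z → rec m (const x) z ≡ x} (λ _ → ≡-modal m _ _)
           (rec-η m (const x)) z)

  -- `◯ (B a)` is itself null, so `η (B a)` is a constant map, and its value is the required point.
  nullification-inhabited : {A : Set} {B : A → Set} → IsNullificationAt B M → ∀ a → ◯ (B a)
  nullification-inhabited {B = B} isNull a =
    inverse (Equivalence.to (isNull (◯ (B a))) (◯-modal (B a)) a) (η (B a))

-- Equality of modalities

module _ (fe : FunExt) where
  open HigherModality

  -- Bundling `◯ A` with its unit lets a single path replace both, leaving only irrelevant data to
  -- compare.
  Reflection : Set → Set₁
  Reflection A = Σ[ B ∈ Set ] (A → B)

  reflection : HigherModality → ∀ A → Reflection A
  reflection M A = ◯ M A , η M A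

  Induction : (∀ A → Reflection A) → Set₁
  Induction R = ∀ A (P : proj₁ (R A) → Set) (f : ∀ x → proj₁ (R (P (proj₂ (R A) x)))) →
                Σ[ g ∈ (∀ z → proj₁ (R (P z))) ] (∀ x → g (proj₂ (R A) x) ≡ f x)

  IdentityModal : (∀ A → Reflection A) → Set₁
  IdentityModal R = ∀ A (y z : proj₁ (R A)) → isEquiv (proj₂ (R (y ≡ z)))

  fromReflection : ∀ R → Induction R → IdentityModal R → HigherModality
  fromReflection R i e = record
    { ◯         = proj₁ ∘ R
    ; η         = λ A → proj₂ (R A)
    ; ind       = λ A P f → proj₁ (i A P f)
    ; ind-η     = λ A P f → proj₂ (i A P f)
    ; η-≡-equiv = e
    }

  fromReflection-≡ : ∀ {R R′} → R ≡ R′ → ∀ i e i′ e′ →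
                     fromReflection R i e ≡ fromReflection R′ i′ e′
  fromReflection-≡ {R} refl i e i′ e′ = cong₂ (fromReflection R)
    (Π-irrelevant fe (λ A → Π-irrelevant fe λ P → Π-irrelevant fe λ f →
      ModalityProperties.extension-irrelevant (fromReflection R i e) fe f) i i′)
    (Π-irrelevant fe (λ A → Π-irrelevant fe λ y → Π-irrelevant fe λ z →
      isEquiv-irrelevant fe _) e e′)

  modality-≡-fromReflection : ∀ M M′ → (∀ A → reflection M A ≡ reflection M′ A) → M ≡ M′
  -- By record eta, `fromReflection` applied to the fields of `M` is `M` itself.
  modality-≡-fromReflection M M′ r = fromReflection-≡ (fe _ _ r)
    (λ A P f → ind M A P f , ind-η M A P f) (η-≡-equiv M)
    (λ A P f → ind M′ A P f , ind-η M′ A P f) (η-≡-equiv M′)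

  reflection-≡ : Univalence → {A B B′ : Set} {u : A → B} {u′ : A → B′} (e : B ≃ B′) →
                 (∀ x → proj₁ e (u x) ≡ u′ x) → (B , u) ≡ (B′ , u′)
  reflection-≡ ua {A} {B} {B′} {u} {u′} e h =
    aux (≡-fromEquiv ua e) (fe _ _ λ x →
      trans (cong (λ e → proj₁ e (u x)) (inverseʳ (ua B B′) e)) (h x))
    where
    aux : {B B′ : Set} {u : A → B} {u′ : A → B′} (p : B ≡ B′) →
          proj₁ (≡⇒≃ p) ∘ u ≡ u′ → _≡_ {A = Reflection A} (B , u) (B′ , u′)
    aux refl refl = refl

  modality-≡ : Univalence → ∀ M M′ → (∀ X → IsModal M X ⇔ IsModal M′ X) → M ≡ M′
  modality-≡ ua M M′ same = modality-≡-fromReflection M M′ λ A →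
    reflection-≡ ua
      (to A , isEquiv-fromInverse (to A) (from A) (to-from A) (from-to A))
      (N.rec-η (◯′-modal A) (η M′ A))
    where
    module N  = ModalityProperties M
    module N′ = ModalityProperties M′

    ◯′-modal : ∀ A → IsModal M (◯ M′ A)
    ◯′-modal A = Equivalence.from (same _) (N′.◯-modal A)

    ◯-modal′ : ∀ A → IsModal M′ (◯ M A)
    ◯-modal′ A = Equivalence.to (same _) (N.◯-modal A)

    to : ∀ A → ◯ M A → ◯ M′ A
    to A = N.rec (◯′-modal A) (η M′ A)

    from : ∀ A → ◯ M′ A → ◯ M A
    from A = N′.rec (◯-modal′ A) (η M A)

    to-from : ∀ A z → to A (from A z) ≡ z
    -- Identities in `◯ M′ A` are modal, so it suffices to check on `η`.
    to-from A = N′.elim (λ z → η-≡-equiv M′ A _ z) λ x →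
      trans (cong (to A) (N′.rec-η (◯-modal′ A) (η M A) x))
            (N.rec-η (◯′-modal A) (η M′ A) x)

    from-to : ∀ A z → from A (to A z) ≡ z
    from-to A = N.elim (λ z → η-≡-equiv M A _ z) λ x →
      trans (cong (from A) (N.rec-η (◯′-modal A) (η M′ A) x))
            (N′.rec-η (◯-modal′ A) (η M A) x)

  nullification-≡ : Univalence → {A A′ : Set} {B : A → Set} {B′ : A′ → Set}
                    {M M′ : HigherModality} →
                    IsNullificationAt B M → IsNullificationAt B′ M′ →
                    (∀ a → Irrelevant (B a)) → (∀ a → Irrelevant (B′ a)) →
                    (∀ a → ◯ M′ (B a)) → (∀ a → ◯ M (B′ a)) → M ≡ M′
  nullification-≡ ua {M = M} {M′} null null′ irr irr′ inh inh′ =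
    modality-≡ ua M M′ λ X → mk⇔
      (λ m → Equivalence.from (null′ X) λ a →
        ModalityProperties.modal⇒null M ua fe (irr′ a) (inh′ a) m)
      (λ m → Equivalence.from (null X) λ a →
        ModalityProperties.modal⇒null M′ ua fe (irr a) (inh a) m)

-- Oracles and the unbounded search

module _ {Ω¬¬ : StableClassifier} where
  open StableClassifier Ω¬¬

  El-irrelevant : ∀ ω → Irrelevant (El ω)
  El-irrelevant ω = proj₁ (proj₂ (proj₁ classify ω))

  -- `unique` gives equality of values only up to double negation, which decidability of equality
  -- removes.
  ↓-irrelevant : {X : Set} → DecidableEquality X → (ν : ∇₀ Ω¬¬ X) → Irrelevant (ν ↓)
  ↓-irrelevant _≟_ ν (x , p) (y , q) =
    aux (decidable-stable (x ≟ y) (∇₀.unique ν x y p q)) p q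
    where
    aux : ∀ {x y} → x ≡ y → (p : ν ↓= x) (q : ν ↓= y) → (x , p) ≡ (y , q)
    aux refl p q = cong (_ ,_) (El-irrelevant _ p q)

  -- Shifting by `m + 1`, as in `IsSuc`, makes `IsSuc (predecessor ν _) ν` hold by the identity.
  predecessor : (ν : ∇₀ Ω¬¬ ℕ) → ¬ (ν ↓= 0) → ∇₀ Ω¬¬ ℕ
  predecessor ν ν≠0 = record
    { ξ         = λ m → ∇₀.ξ ν (m + 1)
    ; inhabited = λ none → ∇₀.inhabited ν λ where
        (zero  , p) → ν≠0 p
        (suc m , p) → none (m , subst (ν ↓=_) (+-comm 1 m) p)
    ; unique    = λ x y p q x≢y →
        ∇₀.unique ν (x + 1) (y + 1) p q (x≢y ∘ +-cancelʳ-≡ 1 x y)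
    }

  graph-false : {A B : Set} (χ : Oracle Ω¬¬ A B) {a : A} {b : B} →
                graph χ (a , b) ↓= false → ¬ (χ a ↓= b)
  graph-false χ {a} {b} = subst id (El-code (negation (χ a ↓= b)))

  decide-graph : {A B : Set} → DecidableEquality B → (χ : Oracle Ω¬¬ A B) →
                 ∀ a b → χ a ↓ → graph χ (a , b) ↓
  decide-graph _≟_ χ a b (c , p) with c ≟ b
  ... | yes refl = true , p
  ... | no c≢b   = false , subst id (sym (El-code (negation (χ a ↓= b))))
                             (λ q → ∇₀.unique (χ a) c b p q c≢b)

  -- ν stands for χ(a) − k, which exists because the values below k are excluded.
  search : {A : Set} → MarkovInduction Ω¬¬ → (χ : Oracle Ω¬¬ A ℕ) (a : A)
           {X : Set} → IsNull (λ p → graph χ p ↓) X → (χ a ↓ → X) → X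
  search MI χ a {X} null f =
    -- `k` is quantified inside the motive because it grows as `ν` descends.
    MI (λ ν → ∀ k → (∀ m → ν ↓= m → χ a ↓= m + k) → X) step (χ a) 0
      (λ m → subst (χ a ↓=_) (+-comm 0 m))
    where
    step : ∀ ν → (∀ μ → IsSuc μ ν → ∀ k → (∀ m → μ ↓= m → χ a ↓= m + k) → X) →
           ∀ k → (∀ m → ν ↓= m → χ a ↓= m + k) → X
    -- Nullity of `X` allows the answer to the query `(a , k)` to be assumed while constructing a
    -- point of `X`.
    step ν rec k shift = inverse (null (a , k)) λ where
      (true  , p) → f (k , p)
      -- A negative answer at `k` rules out `ν ↓= 0`, since `shift 0` would give `χ a ↓= k`.
      (false , p) → rec (predecessor ν (graph-false χ p ∘ shift 0)) (λ _ → id) (1 + k)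
        λ m q → subst (χ a ↓=_) (+-assoc m 1 k) (shift (m + 1) q)

mainTheorem12 : FunExt →
    Univalence →
    (nullify : Nullifications) →
    (Ω¬¬ : StableClassifier) →
    MarkovInduction Ω¬¬ →
    ∀ (χ : Oracle Ω¬¬ ℕ ℕ) → TuringEquivalent nullify χ (graph χ)
mainTheorem12 fe ua nullify Ω¬¬ MI χ =
  nullification-≡ fe ua isNull isNull′
    (λ a → ↓-irrelevant _≟_ (χ a))
    (λ p → ↓-irrelevant Bool._≟_ (graph χ p))
    -- The search takes place in `◯ M′ (χ a ↓)`, which is modal and hence null for the graph.
    (λ a → search MI χ a
      (Equivalence.to (isNull′ _) (ModalityProperties.◯-modal M′ _)) (HigherModality.η M′ _))
    (λ (a , b) → ModalityProperties.◯-map M (decide-graph _≟_ χ a b)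
      (ModalityProperties.nullification-inhabited M isNull a))
  where
  M M′ : HigherModality
  M  = oracleModality nullify χ
  M′ = oracleModality nullify (graph χ)

  isNull : IsNullificationAt (λ a → χ a ↓) M
  isNull = proj₂ (nullify _)

  isNull′ : IsNullificationAt (λ p → graph χ p ↓) M′
  isNull′ = proj₂ (nullify _)
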